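{- Let $k_\mathcal{G}=k_\mathcal{H}=1$ and $n_\mathcal{G},n_\mathcal{H}>1$. Then there is no integer $\ell<(n_\mathcal{G}+n_\mathcal{H}-1)/2$ such that $f_{\text{viz}}$ is $\ell$-SOS modulo $I_{\text{viz}}$ (i.e., there is no SOS-certificate of $f_{\text{viz}}$ of degree $\ell<(n_\mathcal{G}+n_\mathcal{H}-1)/2$).
   Context: Let $\mathbb{K}\subseteq\mathbb{R}$ be a field and $n_\mathcal{G},n_\mathcal{H}$ positive integers. Let $V(\mathcal{G})=\{g_1,\dots,g_{n_\mathcal{G}}\}$, $V(\mathcal{H})=\{h_1,\dots,h_{n_\mathcal{H}}\}$, $V(\mathcal{G}\square\mathcal{H})=V(\mathcal{G})\times V(\mathcal{H})$. Introduce an edge variable $e_{gg'}=e_{g'g}$ for every unordered pair of distinct $g,g'\in V(\mathcal{G})$, an edge variable $e_{hh'}=e_{h'h}$ for every unordered pair of distinct $h,h'\in V(\mathcal{H})$, and a vertex variable $x_{gh}$ for every $(g,h)\in V(\mathcal{G}\square\mathcal{H})$; let $P$ be the polynomial ring over $\mathbb{K}$ in all these variables. For $k_\mathcal{G}=k_\mathcal{H}=1$ (minimum dominating sets $\{g_1\}$ and $\{h_1\}$) the Vizing ideal $I_{\text{viz}}\subseteq P$ is generated by: $e_{gg'}(e_{gg'}-1)$ for all distinct $g,g'\in V(\mathcal{G})$; $1-e_{gg_1}$ for all $g\ne g_1$; $e_{hh'}(e_{hh'}-1)$ for all distinct $h,h'\in V(\mathcal{H})$; $1-e_{hh_1}$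 for all $h\neq h_1$; and, for all $(g,h)$, $x_{gh}(x_{gh}-1)$ and $(1-x_{gh})\prod_{g'\ne g}(1-e_{gg'}x_{g'h})\prod_{h'\neq h}(1-e_{hh'}x_{gh'})$. The Vizing polynomial is $f_{\text{viz}}=\big(\sum_{(g,h)\in V(\mathcal{G}\square\mathcal{H})}x_{gh}\big)-k_\mathcal{G}k_\mathcal{H}$. A polynomial $f\in P$ is $\ell$-SOS modulo an ideal $I$ if there exist $s_1,\dots,s_t\in P$ of degree at most $\ell$ with $f-\sum_{i=1}^t s_i^2\in I$; then $s_1,\dots,s_t$ form an SOS-certificate of degree $\ell$. -}

module Defs where

open import Level using (Level; _⊔_) renaming (suc to lsuc)
open import Algebra.Bundles using (CommutativeRing)
open import Relation.Binary.Structures using (IsTotalOrder)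
open import Relation.Binary.PropositionalEquality using (_≡_; _≢_; refl)
open import Relation.Nullary using (¬_; Dec; yes; no; does)
open import Data.Bool using (Bool; true; false; _∧_; if_then_else_)
open import Data.Nat as ℕ using (ℕ; zero; suc; _≡ᵇ_)
open import Data.Nat.Properties using (<-cmp)
open import Data.Fin using (Fin; toℕ; fromℕ<)
open import Data.Fin.Properties using (toℕ-injective) renaming (_≟_ to _≟F_)
open import Data.Integer as ℤ using (ℤ; +_)
open import Data.List using (List; []; _∷_; map; concatMap; foldr; _++_; allFin)
open import Data.List.Relation.Unary.All using (All)
open import Data.Product using (_×_; _,_; ∃; Σ)
open import Data.Empty using (⊥-elim)
open import Relation.Binary.Definitions using (tri<; tri≈; tri>)

-- Fields K ⊆ ℝ.
-- A field embeds into ℝ iff it admits an Archimedean ordering (and every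
-- subfield of ℝ is Archimedean-ordered by the induced order).

ιℕ : ∀ {c ℓ} (R : CommutativeRing c ℓ) → ℕ → CommutativeRing.Carrier R
ιℕ R zero    = CommutativeRing.0# R
ιℕ R (suc n) = CommutativeRing._+_ R (CommutativeRing.1# R) (ιℕ R n)

record ArchimedeanOrderedField (c ℓ₁ ℓ₂ : Level) : Set (lsuc (c ⊔ ℓ₁ ⊔ ℓ₂)) where
  field
    commutativeRing : CommutativeRing c ℓ₁
  open CommutativeRing commutativeRing public
  field
    0≉1         : ¬ (0# ≈ 1#)
    inverse     : ∀ x → ¬ (x ≈ 0#) → ∃ λ y → (x * y) ≈ 1#
    _≤_         : Carrier → Carrier → Set ℓ₂
    isTotalOrder : IsTotalOrder _≈_ _≤_
    +-mono-≤    : ∀ {x y} z → x ≤ y → (x + z) ≤ (y + z)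
    *-nonneg    : ∀ {x y} → 0# ≤ x → 0# ≤ y → 0# ≤ (x * y)
    archimedean : ∀ x → ∃ λ n → x ≤ ιℕ commutativeRing n

-- Polynomials over a commutative ring R in a finite set of variables.
-- A polynomial is represented by a finite list of terms (coefficient,
-- monomial); two representations denote the same polynomial iff all
-- their coefficients agree (_≋_).

module Polynomials {c ℓ : Level} (R : CommutativeRing c ℓ)
                   (Var : Set) (_≟V_ : (v w : Var) → Dec (v ≡ w))
                   (allVars : List Var) where
  open CommutativeRing R

  Monomial : Set
  Monomial = Var → ℕ

  Term : Set c
  Term = Carrier × Monomial

  Poly : Set c
  Poly = List Term

  monoEqᵇ : Monomial → Monomial → Bool
  monoEqᵇ m m' = foldr (λ v acc → (m v ≡ᵇ m' v) ∧ acc) true allVars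

  coeff : Poly → Monomial → Carrier
  coeff p m = foldr (λ t acc → if monoEqᵇ (Data.Product.proj₁ (swap t)) m
                                 then Data.Product.proj₁ t + acc else acc) 0# p
    where open import Data.Product using (swap)

  _≋_ : Poly → Poly → Set ℓ
  p ≋ q = ∀ (m : Monomial) → coeff p m ≈ coeff q m

  mdeg : Monomial → ℕ
  mdeg m = foldr (λ v acc → m v ℕ.+ acc) 0 allVars

  -- all terms have total degree ≤ d  (d an integer; for d < 0 this forces
  -- the zero polynomial)
  DegLe : ℤ → Poly → Set c
  DegLe d p = All (λ t → (+ mdeg (Data.Product.proj₂ t)) ℤ.≤ d) p

  0P : Poly
  0P = []

  const : Carrier → Poly
  const a = (a , λ _ → 0) ∷ []

  1P : Poly
  1P = const 1#

  var : Var → Poly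
  var v = (1# , λ w → if does (v ≟V w) then 1 else 0) ∷ []

  _⊕_ : Poly → Poly → Poly
  p ⊕ q = p ++ q

  ⊖_ : Poly → Poly
  ⊖ p = map (λ t → (- Data.Product.proj₁ t , Data.Product.proj₂ t)) p

  _⊝_ : Poly → Poly → Poly
  p ⊝ q = p ⊕ (⊖ q)

  _⊗_ : Poly → Poly → Poly
  p ⊗ q = concatMap (λ t → map (λ u → ( Data.Product.proj₁ t * Data.Product.proj₁ u
                                       , λ v → Data.Product.proj₂ t v ℕ.+ Data.Product.proj₂ u v)) q) p

  sumP : List Poly → Poly
  sumP = foldr _⊕_ 0P

  prodP : List Poly → Poly
  prodP = foldr _⊗_ 1P

  InIdeal : {Gen : Set} → (Gen → Poly) → Poly → Set (c ⊔ ℓ)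
  InIdeal {Gen} gen p =
    Σ (List (Poly × Gen)) λ cs →
      p ≋ sumP (map (λ t → Data.Product.proj₁ t ⊗ gen (Data.Product.proj₂ t)) cs)

  IsSOSMod : {Gen : Set} → ℤ → (Gen → Poly) → Poly → Set (c ⊔ ℓ)
  IsSOSMod d gen f =
    Σ (List Poly) λ ss → All (DegLe d) ss × InIdeal gen (f ⊝ sumP (map (λ s → s ⊗ s) ss))

-- The variables of the Vizing ring P for graphs with nG resp. nH vertices.
-- Vertices of G are Fin nG (g_{i+1} ↔ i), vertices of H are Fin nH.
-- Edge variables are indexed by unordered pairs {i, j}, encoded as
-- (j , i) with i < j.

data VizVar (nG nH : ℕ) : Set where
  eG : (j : Fin nG) → Fin (toℕ j) → VizVar nG nH
  eH : (j : Fin nH) → Fin (toℕ j) → VizVar nG nH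
  x  : Fin nG → Fin nH → VizVar nG nH

module _ {nG nH : ℕ} where
  _≟VV_ : (v w : VizVar nG nH) → Dec (v ≡ w)
  eG j i ≟VV eG j' i' with j ≟F j'
  ... | no ne = no λ { refl → ne refl }
  ... | yes refl with i ≟F i'
  ...   | yes refl = yes refl
  ...   | no ne = no λ { refl → ne refl }
  eG _ _ ≟VV eH _ _ = no λ ()
  eG _ _ ≟VV x _ _ = no λ ()
  eH _ _ ≟VV eG _ _ = no λ ()
  eH j i ≟VV eH j' i' with j ≟F j'
  ... | no ne = no λ { refl → ne refl }
  ... | yes refl with i ≟F i'
  ...   | yes refl = yes refl
  ...   | no ne = no λ { refl → ne refl }
  eH _ _ ≟VV x _ _ = no λ ()
  x _ _ ≟VV eG _ _ = no λ ()
  x _ _ ≟VV eH _ _ = no λ ()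
  x g h ≟VV x g' h' with g ≟F g' | h ≟F h'
  ... | yes refl | yes refl = yes refl
  ... | no ne | _ = no λ { refl → ne refl }
  ... | yes _ | no ne = no λ { refl → ne refl }

  allVizVars : List (VizVar nG nH)
  allVizVars =
       concatMap (λ j → map (eG j) (allFin (toℕ j))) (allFin nG)
    ++ concatMap (λ j → map (eH j) (allFin (toℕ j))) (allFin nH)
    ++ concatMap (λ g → map (x g) (allFin nH)) (allFin nG)

  edgeG : (g g' : Fin nG) → g ≢ g' → VizVar nG nH
  edgeG g g' ne with <-cmp (toℕ g) (toℕ g')
  ... | tri< lt _ _ = eG g' (fromℕ< lt)
  ... | tri≈ _ eq _ = ⊥-elim (ne (toℕ-injective eq))
  ... | tri> _ _ gt = eG g (fromℕ< gt)

  edgeH : (h h' : Fin nH) → h ≢ h' → VizVar nG nH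
  edgeH h h' ne with <-cmp (toℕ h) (toℕ h')
  ... | tri< lt _ _ = eH h' (fromℕ< lt)
  ... | tri≈ _ eq _ = ⊥-elim (ne (toℕ-injective eq))
  ... | tri> _ _ gt = eH h (fromℕ< gt)

-- Generators of the Vizing ideal for k_G = k_H = 1 with minimum dominating
-- sets {g₁} and {h₁}, where g₁, h₁ are the vertices with index 0.
data VizGen (nG nH : ℕ) : Set where
  boolEG : (g g' : Fin nG) → g ≢ g' → VizGen nG nH
  domG   : (g g₁ : Fin nG) → toℕ g₁ ≡ 0 → g ≢ g₁ → VizGen nG nH
  boolEH : (h h' : Fin nH) → h ≢ h' → VizGen nG nH
  domH   : (h h₁ : Fin nH) → toℕ h₁ ≡ 0 → h ≢ h₁ → VizGen nG nH
  boolX  : Fin nG → Fin nH → VizGen nG nH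
  domX   : Fin nG → Fin nH → VizGen nG nH

module Vizing {c ℓ₁ ℓ₂ : Level} (K : ArchimedeanOrderedField c ℓ₁ ℓ₂) (nG nH : ℕ) where
  open ArchimedeanOrderedField K using (commutativeRing; 1#)
  open Polynomials commutativeRing (VizVar nG nH) _≟VV_ allVizVars public

  prodNeG : (g : Fin nG) → ((g' : Fin nG) → g' ≢ g → Poly) → Poly
  prodNeG g F = prodP (map f (allFin nG))
    where f : Fin nG → Poly
          f g' with g' ≟F g
          ... | yes _ = 1P
          ... | no ne = F g' ne

  prodNeH : (h : Fin nH) → ((h' : Fin nH) → h' ≢ h → Poly) → Poly
  prodNeH h F = prodP (map f (allFin nH))
    where f : Fin nH → Poly
          f h' with h' ≟F h
          ... | yes _ = 1P
          ... | no ne = F h' ne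

  gen : VizGen nG nH → Poly
  gen (boolEG g g' ne) = var (edgeG g g' ne) ⊗ (var (edgeG g g' ne) ⊝ 1P)
  gen (domG g g₁ _ ne) = 1P ⊝ var (edgeG g g₁ ne)
  gen (boolEH h h' ne) = var (edgeH h h' ne) ⊗ (var (edgeH h h' ne) ⊝ 1P)
  gen (domH h h₁ _ ne) = 1P ⊝ var (edgeH h h₁ ne)
  gen (boolX g h)      = var (x g h) ⊗ (var (x g h) ⊝ 1P)
  gen (domX g h)       =
    (1P ⊝ var (x g h))
      ⊗ (prodNeG g (λ g' ne → 1P ⊝ (var (edgeG g g' (λ e → ne (Relation.Binary.PropositionalEquality.sym e))) ⊗ var (x g' h)))
      ⊗ prodNeH h (λ h' ne → 1P ⊝ (var (edgeH h h' (λ e → ne (Relation.Binary.PropositionalEquality.sym e))) ⊗ var (x g h'))))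

  -- f_viz = Σ x_{gh} − k_G k_H  with k_G = k_H = 1
  fviz : Poly
  fviz = sumP (concatMap (λ g → map (λ h → var (x g h)) (allFin nH)) (allFin nG)) ⊝ const 1#

  VizSOS : ℤ → Set (c ⊔ ℓ₁)
  VizSOS d = IsSOSMod d gen fviz

{-# OPTIONS --safe #-}

-- Set all edge variables to 1 (complete graphs) and let D range over the vertex sets of
-- the product.  A polynomial p of I_viz vanishes at every dominating D.  A
-- non-dominating D is disjoint from some cross, i.e. the union of a row and a column,
-- which has nG + nH − 1 cells.  If deg p < nG + nH − 1, the alternating sum of
-- p(D ∪ U) over all subsets U of the cross is zero, so by downward induction on D the
-- polynomial p vanishes at every D.  For p = f_viz − Σ sᵢ² and D = ∅ this gives
-- −1 = Σ sᵢ(∅)², which is impossible in an ordered field.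
module Submission where

open import Defs
open import Level using (Level)
open import Data.Nat using (ℕ; _<_; _+_)
open import Data.Integer as ℤ using (ℤ; +_)
open import Relation.Nullary using (¬_)

open import Algebra.Bundles using (CommutativeRing)
import Algebra.Properties.Ring as RingProperties
open import Data.Bool using (Bool; true; false; _∧_; _∨_; if_then_else_)
open import Data.Bool.Properties using (∧-zeroʳ)
open import Data.Fin using (Fin; combine; toℕ) renaming (zero to fzero; suc to fsuc)
open import Data.Fin.Properties using (combine-injectiveˡ; combine-injectiveʳ; any?; toℕ-injective)
  renaming (_≟_ to _≟F_)
open import Data.Fin.Subset using (Subset; inside; _⊆_; _⊂_; ⊥) renaming (_∈_ to _∈ˢ_; _∉_ to _∉ˢ_)
open import Data.Fin.Subset.Induction using (⊃-wellFounded; Acc; acc)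
open import Data.Fin.Subset.Properties using (_∈?_; ⊂-⊆-trans)
open import Data.List using (List; []; _∷_; map; concatMap; foldr; _++_; allFin; length)
open import Data.List.Membership.Propositional using (_∈_; lose; find)
open import Data.List.Membership.Propositional.Properties
  using (∈-++⁺ˡ; ∈-++⁺ʳ; ∈-++⁻; ∈-map⁺; ∈-map⁻; ∈-concatMap⁺; ∈-allFin)
open import Data.List.Properties using (length-tabulate)
open import Data.List.Relation.Unary.All as All using (All; []; _∷_)
import Data.List.Relation.Unary.All.Properties as Allₚ
open import Data.List.Relation.Unary.Any as Any using (here; there)
open import Data.Nat using (zero; suc; _*_; _≡ᵇ_; _≤_; z≤n; s≤s)
import Data.Nat.Properties as ℕ
open import Algebra.Properties.CommutativeSemigroup ℕ.+-commutativeSemigroup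
  using () renaming (interchange to ℕ-interchange)
import Data.Integer.Properties as ℤₚ
open import Data.Product using (_×_; _,_; proj₁; proj₂; ∃; ∃₂)
open import Data.Sum using (_⊎_; inj₁; inj₂)
open import Data.Vec using (lookup; _[_]≔_)
open import Data.Vec.Properties
  using ([]≔-commutes; []=⇒lookup; lookup⇒[]=; lookup∘update; lookup∘update′; lookup-replicate)
open import Function using (_∘_)
open import Relation.Binary.Definitions using (tri<; tri≈; tri>)
open import Relation.Binary.PropositionalEquality as ≡ using (_≡_; _≢_; refl; cong; cong₂)
open import Relation.Binary.Structures using (IsTotalOrder)
open import Relation.Nullary using (Dec; yes; no; does; ¬?; contradiction)
open import Relation.Nullary.Decidable using (dec-true; dec-false)

-- Conjunctions and sums over finite lists.

forallᵇ : {A : Set} → (A → Bool) → List A → Bool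
forallᵇ b = foldr (λ v acc → b v ∧ acc) true

module _ {A : Set} where

  forallᵇ-cong : ∀ {b b' : A → Bool} {vs} → All (λ v → b v ≡ b' v) vs → forallᵇ b vs ≡ forallᵇ b' vs
  forallᵇ-cong []       = refl
  forallᵇ-cong (e ∷ es) = cong₂ _∧_ e (forallᵇ-cong es)

  forallᵇ-∧ : ∀ (b b' : A → Bool) vs →
              forallᵇ (λ v → b v ∧ b' v) vs ≡ forallᵇ b vs ∧ forallᵇ b' vs
  forallᵇ-∧ b b' []       = refl
  forallᵇ-∧ b b' (v ∷ vs) rewrite forallᵇ-∧ b b' vs = interchange (b v) (b' v) _ _
    where
    interchange : ∀ p q r s → (p ∧ q) ∧ (r ∧ s) ≡ (p ∧ r) ∧ (q ∧ s)
    interchange true  true  r     s = refl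
    interchange true  false true  s = refl
    interchange true  false false s = refl
    interchange false q     r     s = refl

  forallᵇ-true : ∀ {b : A → Bool} vs → (∀ v → b v ≡ true) → forallᵇ b vs ≡ true
  forallᵇ-true []       h = refl
  forallᵇ-true (v ∷ vs) h rewrite h v = forallᵇ-true vs h

  forallᵇ-false : ∀ {b : A → Bool} {v vs} → v ∈ vs → b v ≡ false → forallᵇ b vs ≡ false
  forallᵇ-false     (here refl) h rewrite h = refl
  forallᵇ-false {b} (there {x = w} i) h rewrite forallᵇ-false {b} i h = ∧-zeroʳ (b w)

  forallᵇ⇒All : ∀ {b : A → Bool} vs → forallᵇ b vs ≡ true → All (λ v → b v ≡ true) vs
  forallᵇ⇒All         []       h = []
  forallᵇ⇒All {b = b} (v ∷ vs) h with b v in e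
  ... | true  = e ∷ forallᵇ⇒All vs h
  ... | false = contradiction h λ ()

total : {A : Set} → (A → ℕ) → List A → ℕ
total m = foldr (λ v acc → m v + acc) 0

module _ {A : Set} where

  total-+ : ∀ (m m' : A → ℕ) vs → total (λ v → m v + m' v) vs ≡ total m vs + total m' vs
  total-+ m m' []       = refl
  total-+ m m' (v ∷ vs) rewrite total-+ m m' vs = ℕ-interchange (m v) (m' v) (total m vs) (total m' vs)

  total-++ : ∀ (m : A → ℕ) vs ws → total m (vs ++ ws) ≡ total m vs + total m ws
  total-++ m []       ws = refl
  total-++ m (v ∷ vs) ws rewrite total-++ m vs ws = ≡.sym (ℕ.+-assoc (m v) _ _)

≡ᵇ-true : ∀ m n → (m ≡ᵇ n) ≡ true → m ≡ n
≡ᵇ-true zero    zero    _ = refl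
≡ᵇ-true (suc m) (suc n) e = cong suc (≡ᵇ-true m n e)

≡ᵇ-refl : ∀ n → (n ≡ᵇ n) ≡ true
≡ᵇ-refl zero    = refl
≡ᵇ-refl (suc n) = ≡ᵇ-refl n

-- Evaluation of polynomials at 0/1 points

module Evaluation {c ℓ} (R : CommutativeRing c ℓ)
                  (Var : Set) (_≟V_ : (v w : Var) → Dec (v ≡ w)) (allVars : List Var) where
  open CommutativeRing R renaming (_+_ to _+ᴿ_; _*_ to _*ᴿ_; refl to ≈-refl)
  open Polynomials R Var _≟V_ allVars
  open RingProperties ring
  open import Algebra.Properties.CommutativeSemigroup *-commutativeSemigroup using (interchange)
  open import Relation.Binary.Reasoning.Setoid setoid

  -- The linear functional with value `φ m` on the monomial `m`. Coefficient extraction and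
  -- evaluation are both instances, so additivity and well-definedness need only one proof.
  linear : (Monomial → Carrier) → Poly → Carrier
  linear φ = foldr (λ t acc → proj₁ t *ᴿ φ (proj₂ t) +ᴿ acc) 0#

  linear-⊕ : ∀ φ p q → linear φ (p ⊕ q) ≈ linear φ p +ᴿ linear φ q
  linear-⊕ φ []      q = sym (+-identityˡ _)
  linear-⊕ φ (t ∷ p) q = trans (+-congˡ (linear-⊕ φ p q)) (sym (+-assoc _ _ _))

  linear-⊖ : ∀ φ p → linear φ (⊖ p) ≈ - linear φ p
  linear-⊖ φ []            = sym -0#≈0#
  linear-⊖ φ ((a , m) ∷ p) = begin
    - a *ᴿ φ m +ᴿ linear φ (⊖ p)   ≈⟨ +-cong (sym (-‿distribˡ-* a (φ m))) (linear-⊖ φ p) ⟩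
    - (a *ᴿ φ m) +ᴿ - linear φ p   ≈⟨ -‿+-comm _ _ ⟩
    - (a *ᴿ φ m +ᴿ linear φ p)     ∎

  linear-⊝ : ∀ φ p q → linear φ (p ⊝ q) ≈ linear φ p - linear φ q
  linear-⊝ φ p q = trans (linear-⊕ φ p (⊖ q)) (+-congˡ (linear-⊖ φ q))

  -- Monomials are functions, identified when they agree on `allVars`. Only a `φ` compatible with
  -- this identification gives a functional on polynomials rather than on term lists.
  Respectful : (Monomial → Carrier) → Set ℓ
  Respectful φ = ∀ m m' → monoEqᵇ m m' ≡ true → φ m ≈ φ m'

  monoEqᵇ⇒All : ∀ m m' → monoEqᵇ m m' ≡ true → All (λ v → m v ≡ m' v) allVars
  monoEqᵇ⇒All m m' e = All.map (λ {v} → ≡ᵇ-true (m v) (m' v)) (forallᵇ⇒All allVars e)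

  monoEqᵇ-refl : ∀ m → monoEqᵇ m m ≡ true
  monoEqᵇ-refl m = forallᵇ-true allVars (λ v → ≡ᵇ-refl (m v))

  δ : Monomial → Monomial → Carrier
  δ m m' = if monoEqᵇ m' m then 1# else 0#

  δ-respectful : ∀ m → Respectful (δ m)
  δ-respectful k m m' e = reflexive (cong (λ b → if b then 1# else 0#)
    (forallᵇ-cong (All.map (λ {v} → cong (_≡ᵇ k v)) (monoEqᵇ⇒All m m' e))))

  coeff≈linear : ∀ p m → coeff p m ≈ linear (δ m) p
  coeff≈linear []             m = ≈-refl
  coeff≈linear ((a , m') ∷ p) m with monoEqᵇ m' m
  ... | true  = +-cong (sym (*-identityʳ a)) (coeff≈linear p m)
  ... | false = trans (coeff≈linear p m) (sym (trans (+-congʳ (zeroʳ a)) (+-identityˡ _)))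

  without : Monomial → Poly → Poly
  without m []      = []
  without m (t ∷ p) = if monoEqᵇ (proj₂ t) m then without m p else t ∷ without m p

  length-without : ∀ m p → length (without m p) ≤ length p
  length-without m []      = z≤n
  length-without m (t ∷ p) with monoEqᵇ (proj₂ t) m
  ... | true  = ℕ.m≤n⇒m≤1+n (length-without m p)
  ... | false = s≤s (length-without m p)

  -- Collects like terms: the terms whose monomial agrees with `m` contribute `φ m` times their
  -- total coefficient.
  linear-without : ∀ {φ} → Respectful φ → ∀ m p →
                   linear φ p ≈ coeff p m *ᴿ φ m +ᴿ linear φ (without m p)
  linear-without {φ} resp m [] = sym (trans (+-congʳ (zeroˡ _)) (+-identityˡ _))
  linear-without {φ} resp m ((a , m') ∷ p) with monoEqᵇ m' m in e
  ... | true  = begin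
    a *ᴿ φ m' +ᴿ linear φ p
      ≈⟨ +-cong (*-congˡ (resp m' m e)) (linear-without resp m p) ⟩
    a *ᴿ φ m +ᴿ (coeff p m *ᴿ φ m +ᴿ linear φ (without m p))
      ≈⟨ +-assoc _ _ _ ⟨
    (a *ᴿ φ m +ᴿ coeff p m *ᴿ φ m) +ᴿ linear φ (without m p)
      ≈⟨ +-congʳ (distribʳ _ _ _) ⟨
    (a +ᴿ coeff p m) *ᴿ φ m +ᴿ linear φ (without m p) ∎
  ... | false = begin
    a *ᴿ φ m' +ᴿ linear φ p
      ≈⟨ +-congˡ (linear-without resp m p) ⟩
    a *ᴿ φ m' +ᴿ (coeff p m *ᴿ φ m +ᴿ linear φ (without m p))
      ≈⟨ +-assoc _ _ _ ⟨
    (a *ᴿ φ m' +ᴿ coeff p m *ᴿ φ m) +ᴿ linear φ (without m p)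
      ≈⟨ +-congʳ (+-comm _ _) ⟩
    (coeff p m *ᴿ φ m +ᴿ a *ᴿ φ m') +ᴿ linear φ (without m p)
      ≈⟨ +-assoc _ _ _ ⟩
    coeff p m *ᴿ φ m +ᴿ (a *ᴿ φ m' +ᴿ linear φ (without m p)) ∎

  linear-without-0 : ∀ {φ p} → Respectful φ → ∀ m → coeff p m ≈ 0# →
                     linear φ p ≈ linear φ (without m p)
  linear-without-0 {φ} {p} resp m z =
    trans (linear-without resp m p)
          (trans (+-congʳ (trans (*-congʳ z) (zeroˡ _))) (+-identityˡ _))

  -- All terms sharing the first monomial contribute zero together and can be deleted. The remaining
  -- list is shorter but not a structural part of `p`, hence the induction on the length bound `n`.
  linear-null : ∀ {φ} → Respectful φ → ∀ n p → length p ≤ n →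
                (∀ m → coeff p m ≈ 0#) → linear φ p ≈ 0#
  linear-null resp n       []      _         z = ≈-refl
  linear-null {φ} resp (suc n) p@((a , m) ∷ p') (s≤s len) z =
    trans (linear-without-0 {φ} {p} resp m (z m))
          (linear-null {φ} resp n (without m p) shorter z')
    where
    shorter : length (without m p) ≤ n
    shorter rewrite monoEqᵇ-refl m = ℕ.≤-trans (length-without m p') len
    z' : ∀ k → coeff (without m p) k ≈ 0#
    -- Taking a coefficient is itself `linear (δ k)`, so the deletion leaves it unchanged too.
    z' k = begin
      coeff (without m p) k        ≈⟨ coeff≈linear (without m p) k ⟩
      linear (δ k) (without m p)   ≈⟨ linear-without-0 {δ k} {p} (δ-respectful k) m (z m) ⟨
      linear (δ k) p               ≈⟨ coeff≈linear p k ⟨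
      coeff p k                    ≈⟨ z k ⟩
      0#                           ∎

  linear-cong : ∀ {φ} → Respectful φ → ∀ p q → p ≋ q → linear φ p ≈ linear φ q
  linear-cong {φ} resp p q p≋q = x∙y⁻¹≈ε⇒x≈y _ _
    (trans (sym (linear-⊝ φ p q)) (linear-null {φ} resp _ (p ⊝ q) ℕ.≤-refl z))
    where
    z : ∀ m → coeff (p ⊝ q) m ≈ 0#
    z m = begin
      coeff (p ⊝ q) m                  ≈⟨ coeff≈linear (p ⊝ q) m ⟩
      linear (δ m) (p ⊝ q)             ≈⟨ linear-⊝ (δ m) p q ⟩
      linear (δ m) p - linear (δ m) q  ≈⟨ +-cong (coeff≈linear p m) (-‿cong (coeff≈linear q m)) ⟨
      coeff p m - coeff q m            ≈⟨ x≈y⇒x∙y⁻¹≈ε (p≋q m) ⟩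
      0#                               ∎

  indicator : Bool → Carrier
  indicator b = if b then 1# else 0#

  indicator-∧ : ∀ b b' → indicator (b ∧ b') ≈ indicator b *ᴿ indicator b'
  indicator-∧ true  b' = sym (*-identityˡ _)
  indicator-∧ false b' = sym (zeroˡ _)

  -- At a 0/1 point a power is 1 if its exponent is 0 and equals the coordinate otherwise, so the
  -- value of a monomial is a Boolean conjunction.
  monoval : (Var → Bool) → Monomial → Bool
  monoval σ m = forallᵇ (λ v → (m v ≡ᵇ 0) ∨ σ v) allVars

  eval : (Var → Bool) → Poly → Carrier
  eval σ = linear (indicator ∘ monoval σ)

  eval-cong : ∀ σ p q → p ≋ q → eval σ p ≈ eval σ q
  eval-cong σ p q = linear-cong
    (λ m m' e → reflexive (cong indicator
      (forallᵇ-cong (All.map (λ {v} → cong (λ k → (k ≡ᵇ 0) ∨ σ v)) (monoEqᵇ⇒All m m' e)))))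
    p q

  -- Only the vanishing of exponents matters, and a sum of exponents is 0 exactly when both are.
  monoval-+ : ∀ σ m m' → monoval σ (λ v → m v + m' v) ≡ monoval σ m ∧ monoval σ m'
  monoval-+ σ m m' = ≡.trans
    (forallᵇ-cong (All.universal (λ v → pointwise (m v) (m' v) (σ v)) allVars))
    (forallᵇ-∧ _ _ allVars)
    where
    pointwise : ∀ k l b → ((k + l) ≡ᵇ 0) ∨ b ≡ ((k ≡ᵇ 0) ∨ b) ∧ ((l ≡ᵇ 0) ∨ b)
    pointwise zero    zero    b     = refl
    pointwise zero    (suc l) b     = refl
    pointwise (suc k) zero    true  = refl
    pointwise (suc k) zero    false = refl
    pointwise (suc k) (suc l) true  = refl
    pointwise (suc k) (suc l) false = refl

  eval-⊗ : ∀ σ p q → eval σ (p ⊗ q) ≈ eval σ p *ᴿ eval σ q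
  eval-⊗ σ []            q = sym (zeroˡ _)
  eval-⊗ σ ((a , m) ∷ p) q = begin
    eval σ (shift q ⊕ (p ⊗ q))                ≈⟨ linear-⊕ _ (shift q) (p ⊗ q) ⟩
    eval σ (shift q) +ᴿ eval σ (p ⊗ q)        ≈⟨ +-cong (eval-shift q) (eval-⊗ σ p q) ⟩
    a *ᴿ φ m *ᴿ eval σ q +ᴿ eval σ p *ᴿ eval σ q ≈⟨ distribʳ _ _ _ ⟨
    (a *ᴿ φ m +ᴿ eval σ p) *ᴿ eval σ q          ∎
    where
    φ = indicator ∘ monoval σ
    shift : Poly → Poly
    shift = map (λ u → a *ᴿ proj₁ u , λ v → m v + proj₂ u v)
    eval-shift : ∀ r → eval σ (shift r) ≈ a *ᴿ φ m *ᴿ eval σ r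
    eval-shift []             = sym (zeroʳ _)
    eval-shift ((b , m') ∷ r) = begin
      a *ᴿ b *ᴿ φ (λ v → m v + m' v) +ᴿ eval σ (shift r)
        ≈⟨ +-cong (*-congˡ (trans (reflexive (cong indicator (monoval-+ σ m m')))
                                  (indicator-∧ (monoval σ m) (monoval σ m'))))
                  (eval-shift r) ⟩
      a *ᴿ b *ᴿ (φ m *ᴿ φ m') +ᴿ a *ᴿ φ m *ᴿ eval σ r
        ≈⟨ +-congʳ (interchange a b (φ m) (φ m')) ⟩
      a *ᴿ φ m *ᴿ (b *ᴿ φ m') +ᴿ a *ᴿ φ m *ᴿ eval σ r
        ≈⟨ distribˡ _ _ _ ⟨
      a *ᴿ φ m *ᴿ (b *ᴿ φ m' +ᴿ eval σ r) ∎

  eval-⊝ : ∀ σ p q → eval σ (p ⊝ q) ≈ eval σ p - eval σ q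
  eval-⊝ σ = linear-⊝ (indicator ∘ monoval σ)

  eval-1P : ∀ σ → eval σ 1P ≈ 1#
  eval-1P σ = begin
    1# *ᴿ indicator (monoval σ (λ _ → 0)) +ᴿ 0#  ≈⟨ +-identityʳ _ ⟩
    1# *ᴿ indicator (monoval σ (λ _ → 0))        ≈⟨ *-identityˡ _ ⟩
    indicator (monoval σ (λ _ → 0))             ≡⟨ cong indicator (forallᵇ-true allVars (λ _ → refl)) ⟩
    1#                                          ∎

  eval-var : ∀ σ {v} → v ∈ allVars → eval σ (var v) ≈ indicator (σ v)
  eval-var σ {v} v∈ =
    trans (+-identityʳ _) (trans (*-identityˡ _) (reflexive (cong indicator monoval-var)))
    where
    factor : Var → Bool
    factor w = ((if does (v ≟V w) then 1 else 0) ≡ᵇ 0) ∨ σ w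
    factor-self : factor v ≡ σ v
    factor-self rewrite dec-true (v ≟V v) refl = refl
    monoval-var : forallᵇ factor allVars ≡ σ v
    -- If `σ v` is false, the factor at `v` makes the conjunction false. If it is true, every other
    -- factor is true as well, its exponent being 0.
    monoval-var with σ v in e
    ... | false = forallᵇ-false v∈ (≡.trans factor-self e)
    ... | true  = forallᵇ-true allVars factor-true
      where
      factor-true : ∀ w → factor w ≡ true
      factor-true w with v ≟V w
      ... | yes refl = e
      ... | no  _    = refl

  eval-⊗-0ˡ : ∀ σ p q → eval σ p ≈ 0# → eval σ (p ⊗ q) ≈ 0#
  eval-⊗-0ˡ σ p q z = trans (eval-⊗ σ p q) (trans (*-congʳ z) (zeroˡ _))

  eval-⊗-0ʳ : ∀ σ p q → eval σ q ≈ 0# → eval σ (p ⊗ q) ≈ 0#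
  eval-⊗-0ʳ σ p q z = trans (eval-⊗ σ p q) (trans (*-congˡ z) (zeroʳ _))

  eval-prodP-0 : ∀ σ {A : Set} (f : A → Poly) {a as} → a ∈ as →
                 eval σ (f a) ≈ 0# → eval σ (prodP (map f as)) ≈ 0#
  eval-prodP-0 σ f {a} (here refl)       z = eval-⊗-0ˡ σ (f a) _ z
  eval-prodP-0 σ f     (there {x = b} i) z = eval-⊗-0ʳ σ (f b) _ (eval-prodP-0 σ f i z)

  eval-sumP-0 : ∀ σ ps → All (λ p → eval σ p ≈ 0#) ps → eval σ (sumP ps) ≈ 0#
  eval-sumP-0 σ []       []       = ≈-refl
  eval-sumP-0 σ (p ∷ ps) (z ∷ zs) =
    trans (linear-⊕ _ p _) (trans (+-cong z (eval-sumP-0 σ ps zs)) (+-identityˡ _))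

  eval-ideal : ∀ σ {Gen : Set} (gen : Gen → Poly) → (∀ γ → eval σ (gen γ) ≈ 0#) →
               ∀ p → InIdeal gen p → eval σ p ≈ 0#
  eval-ideal σ gen z p (cs , e) =
    trans (eval-cong σ p (sumP (map multiple cs)) e)
          (eval-sumP-0 σ (map multiple cs) (Allₚ.map⁺ (All.universal multiple-0 cs)))
    where
    multiple : _ → Poly
    multiple t = proj₁ t ⊗ gen (proj₂ t)
    multiple-0 : ∀ t → eval σ (multiple t) ≈ 0#
    multiple-0 (q , γ) = eval-⊗-0ʳ σ q (gen γ) (z γ)

  eval-idempotent : ∀ σ {v} → v ∈ allVars → eval σ (var v ⊗ (var v ⊝ 1P)) ≈ 0#
  eval-idempotent σ {v} v∈ = begin
    eval σ (var v ⊗ (var v ⊝ 1P))             ≈⟨ eval-⊗ σ (var v) (var v ⊝ 1P) ⟩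
    eval σ (var v) *ᴿ eval σ (var v ⊝ 1P)      ≈⟨ *-cong (eval-var σ v∈) (trans (eval-⊝ σ (var v) 1P)
                                                   (+-cong (eval-var σ v∈) (-‿cong (eval-1P σ)))) ⟩
    indicator (σ v) *ᴿ (indicator (σ v) - 1#)  ≈⟨ boolean (σ v) ⟩
    0#                                        ∎
    where
    boolean : ∀ b → indicator b *ᴿ (indicator b - 1#) ≈ 0#
    boolean true  = trans (*-identityˡ _) (-‿inverseʳ 1#)
    boolean false = zeroˡ _

  eval-1⊝ : ∀ σ p → eval σ p ≈ 1# → eval σ (1P ⊝ p) ≈ 0#
  eval-1⊝ σ p e = trans (eval-⊝ σ 1P p) (trans (+-cong (eval-1P σ) (-‿cong e)) (-‿inverseʳ 1#))

  mdeg-+ : ∀ m m' → mdeg (λ v → m v + m' v) ≡ mdeg m + mdeg m'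
  mdeg-+ m m' = total-+ m m' allVars

-- Finite differences on the lattice of subsets

insert : ∀ {n} → Fin n → Subset n → Subset n
insert c D = D [ c ]≔ inside

insert-comm : ∀ {n} (c c' : Fin n) D → insert c (insert c' D) ≡ insert c' (insert c D)
insert-comm c c' D with c' ≟F c
... | yes refl = refl
... | no  c'≢c = []≔-commutes D c' c c'≢c

∈-insert : ∀ {n} (c : Fin n) D → c ∈ˢ insert c D
∈-insert c D = lookup⇒[]= c _ (lookup∘update c D inside)

⊆-insert : ∀ {n} (c : Fin n) D → D ⊆ insert c D
⊆-insert c D {x = i} i∈D with i ≟F c
... | yes refl = ∈-insert c D
... | no  i≢c  = lookup⇒[]= i _ (≡.trans (lookup∘update′ i≢c D inside) ([]=⇒lookup i∈D))

⊂-insert : ∀ {n} {c : Fin n} {D} → c ∉ˢ D → D ⊂ insert c D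
⊂-insert {c = c} {D} c∉D = ⊆-insert c D , c , ∈-insert c D , c∉D

module Difference {c ℓ} (R : CommutativeRing c ℓ) (n : ℕ) where
  open CommutativeRing R renaming (_+_ to _+ᴿ_; _*_ to _*ᴿ_; refl to ≈-refl)
  open RingProperties ring
  open import Algebra.Properties.CommutativeSemigroup +-commutativeSemigroup using (interchange)
  open import Relation.Binary.Reasoning.Setoid setoid

  -- The alternating sum of `F (D ∪ U)` over the subsets U of `cs`, written as an iterated first
  -- difference.
  diff : List (Fin n) → (Subset n → Carrier) → Subset n → Carrier
  diff []       F D = F D
  diff (c ∷ cs) F D = diff cs F D - diff cs F (insert c D)

  0-0≈0 : ∀ {a b} → a ≈ 0# → b ≈ 0# → a - b ≈ 0#
  0-0≈0 a≈0 b≈0 = x≈y⇒x∙y⁻¹≈ε (trans a≈0 (sym b≈0))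

  diff-+ : ∀ cs F G D → diff cs (λ E → F E +ᴿ G E) D ≈ diff cs F D +ᴿ diff cs G D
  diff-+ []       F G D = ≈-refl
  diff-+ (c ∷ cs) F G D = begin
    diff cs (λ E → F E +ᴿ G E) D - diff cs (λ E → F E +ᴿ G E) D'
      ≈⟨ +-cong (diff-+ cs F G D) (-‿cong (diff-+ cs F G D')) ⟩
    (diff cs F D +ᴿ diff cs G D) - (diff cs F D' +ᴿ diff cs G D')
      ≈⟨ +-congˡ (-‿+-comm _ _) ⟨
    (diff cs F D +ᴿ diff cs G D) +ᴿ (- diff cs F D' - diff cs G D')
      ≈⟨ interchange _ _ _ _ ⟩
    (diff cs F D - diff cs F D') +ᴿ (diff cs G D - diff cs G D') ∎
    where D' = insert c D

  diff-vanishing : ∀ cs {F} D → (∀ {E} → D ⊆ E → F E ≈ 0#) → diff cs F D ≈ 0#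
  diff-vanishing []       D z = z (λ i → i)
  diff-vanishing (c ∷ cs) D z =
    0-0≈0 (diff-vanishing cs D z) (diff-vanishing cs (insert c D) (λ s → z (s ∘ ⊆-insert c D)))

  -- Since `cs` is disjoint from `D`, every summand except the one with U empty is taken at a
  -- strictly larger set, where `F` vanishes.
  diff-leading : ∀ {cs F D} → All (_∉ˢ D) cs → (∀ {E} → D ⊂ E → F E ≈ 0#) → diff cs F D ≈ F D
  diff-leading []                               z = ≈-refl
  diff-leading {c ∷ cs} {F} {D} (c∉D ∷ cs∉D) z = begin
    diff cs F D - diff cs F (insert c D)
      ≈⟨ +-cong (diff-leading cs∉D z)
                (-‿cong (diff-vanishing cs (insert c D) (λ s → z (⊂-⊆-trans (⊂-insert c∉D) s)))) ⟩
    F D - 0#   ≈⟨ +-congˡ -0#≈0# ⟩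
    F D +ᴿ 0#  ≈⟨ +-identityʳ _ ⟩
    F D        ∎

  -- Insertions commute, so an invariance of `F` under inserting `c` passes through every further
  -- difference.
  diff-invariant : ∀ c F → (∀ D → F (insert c D) ≈ F D) →
                   ∀ cs D → diff cs F (insert c D) ≈ diff cs F D
  diff-invariant c F inv []        D = inv D
  diff-invariant c F inv (c' ∷ cs) D = +-cong (diff-invariant c F inv cs D) (-‿cong (begin
    diff cs F (insert c' (insert c D))  ≡⟨ cong (diff cs F) (insert-comm c' c D) ⟩
    diff cs F (insert c (insert c' D))  ≈⟨ diff-invariant c F inv cs (insert c' D) ⟩
    diff cs F (insert c' D)             ∎))

  -- The summands for U without `c` and for U together with `c` cancel in pairs.
  diff-null : ∀ {c cs F} → c ∈ cs → (∀ D → F (insert c D) ≈ F D) → ∀ D → diff cs F D ≈ 0#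
  diff-null {c} {_ ∷ cs} {F} (here refl) inv D = x≈y⇒x∙y⁻¹≈ε (sym (diff-invariant c F inv cs D))
  diff-null {c} {c' ∷ _}     (there i)   inv D = 0-0≈0 (diff-null i inv D) (diff-null i inv (insert c' D))

-- Dominating sets of the product of two complete graphs

module CompleteProduct (nG nH : ℕ) where

  ∈-allVizVars : (v : VizVar nG nH) → v ∈ allVizVars
  ∈-allVizVars (eG j i) =
    ∈-++⁺ˡ (∈-concatMap⁺ _ (lose (∈-allFin j) (∈-map⁺ (eG j) (∈-allFin i))))
  ∈-allVizVars (eH j i) =
    ∈-++⁺ʳ (concatMap (λ j → map (eG j) (allFin _)) (allFin nG))
      (∈-++⁺ˡ (∈-concatMap⁺ _ (lose (∈-allFin j) (∈-map⁺ (eH j) (∈-allFin i)))))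
  ∈-allVizVars (x g h) =
    ∈-++⁺ʳ (concatMap (λ j → map (eG j) (allFin _)) (allFin nG))
      (∈-++⁺ʳ (concatMap (λ j → map (eH j) (allFin _)) (allFin nH))
        (∈-concatMap⁺ _ (lose (∈-allFin g) (∈-map⁺ (x g) (∈-allFin h)))))

  -- The corner (g , h) is listed twice; this is harmless because insert is idempotent.
  cross : Fin nG → Fin nH → List (Fin (nG * nH))
  cross g h = map (λ g' → combine g' h) (allFin nG) ++ map (combine g) (allFin nH)

  column∈cross : ∀ g h (g' : Fin nG) → combine g' h ∈ cross g h
  column∈cross g h g' = ∈-++⁺ˡ (∈-map⁺ (λ (g' : Fin nG) → combine g' h) (∈-allFin g'))

  row∈cross : ∀ g h (h' : Fin nH) → combine g h' ∈ cross g h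
  row∈cross g h h' = ∈-++⁺ʳ (map (λ g' → combine g' h) (allFin nG)) (∈-map⁺ (combine g) (∈-allFin h'))

  -- This is the form in which low degree is used: a monomial missing the variable of one cell of
  -- `cs` is annihilated by the difference over `cs`.
  Avoids : List (Fin (nG * nH)) → (VizVar nG nH → ℕ) → Set
  Avoids cs m = ∃₂ λ g h → combine g h ∈ cs × m (x g h) ≡ 0

  module _ (m : VizVar nG nH → ℕ) (g : Fin nG) (h : Fin nH)
           (column>0 : ∀ g' → 1 ≤ m (x g' h)) (row>0 : ∀ h' → 1 ≤ m (x g h')) where

    rowVars : Fin nG → List (VizVar nG nH)
    rowVars g' = map (x g') (allFin nH)

    total-row≥1 : ∀ g' → 1 ≤ total m (rowVars g')
    total-row≥1 g' = go (∈-allFin h)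
      where
      go : ∀ {hs} → h ∈ hs → 1 ≤ total m (map (x g') hs)
      go (here refl)        = ℕ.≤-trans (column>0 g') (ℕ.m≤m+n _ _)
      go (there {x = h'} i) = ℕ.≤-trans (go i) (ℕ.m≤n+m _ (m (x g' h')))

    total-fullRow : nH ≤ total m (rowVars g)
    total-fullRow = ℕ.≤-trans (ℕ.≤-reflexive (≡.sym (length-tabulate (λ i → i)))) (go (allFin nH))
      where
      go : ∀ hs → length hs ≤ total m (map (x g) hs)
      go []        = z≤n
      go (h' ∷ hs) = ℕ.+-mono-≤ (row>0 h') (go hs)

    total-rows : ∀ gs → length gs ≤ total m (concatMap rowVars gs)
    total-rows []        = z≤n
    total-rows (g' ∷ gs) rewrite total-++ m (rowVars g') (concatMap rowVars gs) =
      ℕ.+-mono-≤ (total-row≥1 g') (total-rows gs)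

    -- Row `g` contributes at least `nH`, and every other row at least 1 through its cell in column
    -- `h`. The `suc` accounts for the corner, which lies in both lines of the cross.
    total-cross : ∀ {gs} → g ∈ gs → length gs + nH ≤ suc (total m (concatMap rowVars gs))
    total-cross {_ ∷ gs} (here refl) rewrite total-++ m (rowVars g) (concatMap rowVars gs) =
      s≤s (ℕ.≤-trans (ℕ.≤-reflexive (ℕ.+-comm (length gs) nH)) (ℕ.+-mono-≤ total-fullRow (total-rows gs)))
    total-cross {g' ∷ gs} (there i) rewrite total-++ m (rowVars g') (concatMap rowVars gs) =
      s≤s (ℕ.≤-trans (total-cross i) (ℕ.+-monoˡ-≤ _ (total-row≥1 g')))

    -- The cell variables form the last block of `allVizVars`; the edge variables before them can
    -- only increase the degree.
    cross≤total : nG + nH ≤ suc (total m allVizVars)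
    cross≤total = ℕ.≤-trans
      (ℕ.≤-trans (ℕ.≤-reflexive (cong (_+ nH) (≡.sym (length-tabulate (λ i → i)))))
                 (total-cross (∈-allFin g)))
      (s≤s (ℕ.≤-trans (suffix≤ edgesH (concatMap rowVars (allFin nG))) (suffix≤ edgesG _)))
      where
      edgesG edgesH : List (VizVar nG nH)
      edgesG = concatMap (λ j → map (eG j) (allFin _)) (allFin nG)
      edgesH = concatMap (λ j → map (eH j) (allFin _)) (allFin nH)
      suffix≤ : ∀ vs ws → total m ws ≤ total m (vs ++ ws)
      suffix≤ vs ws rewrite total-++ m vs ws = ℕ.m≤n+m _ _

  -- A monomial containing every cell variable of the cross has degree at least `nG + nH` minus 1.
  -- The finite search turns this contrapositive into an explicit missing cell.
  lowDegree⇒Avoids : ∀ m → suc (total m allVizVars) < nG + nH → ∀ g h → Avoids (cross g h) m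
  lowDegree⇒Avoids m low g h
    with any? (λ g' → m (x g' h) ℕ.≟ 0) | any? (λ h' → m (x g h') ℕ.≟ 0)
  ... | yes (g' , e) | _            = g' , h , column∈cross g h g' , e
  ... | no _         | yes (h' , e) = g , h' , row∈cross g h h' , e
  ... | no column    | no row       = contradiction
    (cross≤total m g h (λ g' → ℕ.n≢0⇒n>0 (λ e → column (g' , e))) (λ h' → ℕ.n≢0⇒n>0 (λ e → row (h' , e))))
    (ℕ.<⇒≱ low)

  -- Column `h` has a cell outside row `g₀`, because there are at least two rows; its variable is
  -- not `x g₀ h₀`.
  singleVar-Avoids : 1 < nG → ∀ g₀ h₀ g h → Avoids (cross g h) (λ w → if does (x g₀ h₀ ≟VV w) then 1 else 0)
  singleVar-Avoids 1<nG g₀ h₀ g h with another 1<nG g₀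
    where
    another : ∀ {n} → 1 < n → (i : Fin n) → ∃ (_≢ i)
    another (s≤s (s≤s _)) fzero    = fsuc fzero , λ ()
    another (s≤s (s≤s _)) (fsuc i) = fzero , λ ()
  ... | g' , g'≢g₀ = g' , h , column∈cross g h g' ,
    cong (λ b → if b then 1 else 0) (dec-false (x g₀ h₀ ≟VV x g' h) λ { refl → g'≢g₀ refl })

  -- In the product of complete graphs the closed neighbourhood of (g , h) is exactly `cross g h`.
  Undominated : Subset (nG * nH) → Set
  Undominated D = ∃₂ λ g h → All (_∉ˢ D) (cross g h)

  undominated? : ∀ D → Dec (Undominated D)
  undominated? D = any? λ g → any? λ h → All.all? (λ i → ¬? (i ∈? D)) (cross g h)

  -- The column and row cases match the two products in the generator `domX g h`.
  dominating : ∀ {D} → ¬ Undominated D → ∀ g h →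
               (∃ λ g' → combine g' h ∈ˢ D) ⊎ (∃ λ h' → combine g h' ∈ˢ D)
  dominating {D} dom g h with Any.any? (_∈? D) (cross g h)
  ... | no  none = contradiction (g , h , Allₚ.¬Any⇒All¬ _ none) dom
  ... | yes some with find some
  ...   | c , c∈cross , c∈D with ∈-++⁻ (map (λ g' → combine g' h) (allFin nG)) c∈cross
  ...     | inj₁ c∈column with ∈-map⁻ (λ g' → combine g' h) c∈column
  ...       | g' , _ , refl = inj₁ (g' , c∈D)
  dominating {D} dom g h | yes some | c , c∈cross , c∈D | inj₂ c∈row with ∈-map⁻ (combine g) c∈row
  ...       | h' , _ , refl = inj₂ (h' , c∈D)

  point : Subset (nG * nH) → VizVar nG nH → Bool
  point D (eG _ _) = true
  point D (eH _ _) = true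
  point D (x g h)  = lookup D (combine g h)

  point-edgeG : ∀ D g g' ne → point D (edgeG g g' ne) ≡ true
  point-edgeG D g g' ne with ℕ.<-cmp (toℕ g) (toℕ g')
  ... | tri< _ _ _ = refl
  ... | tri≈ _ e _ = contradiction (toℕ-injective e) ne
  ... | tri> _ _ _ = refl

  point-edgeH : ∀ D h h' ne → point D (edgeH h h' ne) ≡ true
  point-edgeH D h h' ne with ℕ.<-cmp (toℕ h) (toℕ h')
  ... | tri< _ _ _ = refl
  ... | tri≈ _ e _ = contradiction (toℕ-injective e) ne
  ... | tri> _ _ _ = refl

-- Low-degree elements of the Vizing ideal at the points of the complete graphs.

module VizingBound {c ℓ₁ ℓ₂} (K : ArchimedeanOrderedField c ℓ₁ ℓ₂) (nG nH : ℕ) where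
  open ArchimedeanOrderedField K
    renaming (_+_ to _+ᴷ_; _*_ to _*ᴷ_; _≤_ to infix 4 _≤ᴷ_; refl to ≈-refl; +-mono-≤ to +ᴷ-mono-≤)
  open Vizing K nG nH
  open Evaluation commutativeRing (VizVar nG nH) _≟VV_ allVizVars
  open CompleteProduct nG nH
  open Difference commutativeRing (nG * nH)
  open RingProperties ring

  -- The two points differ at most in the coordinate `x g h`, on which `m` does not depend.
  monoval-insert : ∀ m g h → m (x g h) ≡ 0 → ∀ D →
                   monoval (point (insert (combine g h) D)) m ≡ monoval (point D) m
  monoval-insert m g h m≡0 D = forallᵇ-cong (All.universal same allVizVars)
    where
    same : ∀ v → (m v ≡ᵇ 0) ∨ point (insert (combine g h) D) v ≡ (m v ≡ᵇ 0) ∨ point D v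
    same (eG _ _)  = refl
    same (eH _ _)  = refl
    same (x g' h') with combine g' h' ≟F combine g h
    ... | no  ne = cong ((m (x g' h') ≡ᵇ 0) ∨_) (lookup∘update′ ne D inside)
    ... | yes eq with combine-injectiveˡ g' h' g h eq | combine-injectiveʳ g' h' g h eq
    ...   | refl | refl rewrite m≡0 = refl

  -- By linearity each term is treated alone, so different terms may avoid different cells of `cs`.
  diff-eval : ∀ cs p → All (Avoids cs ∘ proj₂) p → ∀ D → diff cs (λ E → eval (point E) p) D ≈ 0#
  diff-eval cs []            []                            D = diff-vanishing cs D (λ _ → ≈-refl)
  diff-eval cs ((a , m) ∷ p) ((g , h , c∈cs , m≡0) ∷ avoid) D =
    trans (diff-+ cs (λ E → a *ᴷ indicator (monoval (point E) m)) (λ E → eval (point E) p) D)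
          (trans (+-cong (diff-null c∈cs (λ E → *-congˡ (reflexive (cong indicator
                           (monoval-insert m g h m≡0 E)))) D)
                         (diff-eval cs p avoid D))
                 (+-identityˡ 0#))

  module _ (D : Subset (nG * nH)) where

    eval-true : ∀ v → point D v ≡ true → eval (point D) (var v) ≈ 1#
    eval-true v e = trans (eval-var (point D) (∈-allVizVars v)) (reflexive (cong indicator e))

    eval-1⊝var : ∀ v → point D v ≡ true → eval (point D) (1P ⊝ var v) ≈ 0#
    eval-1⊝var v e = eval-1⊝ (point D) (var v) (eval-true v e)

    eval-edge·vertex : ∀ v w → point D v ≡ true → point D w ≡ true →
                       eval (point D) (1P ⊝ (var v ⊗ var w)) ≈ 0#
    eval-edge·vertex v w e e' = eval-1⊝ (point D) (var v ⊗ var w)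
      (trans (eval-⊗ (point D) (var v) (var w))
        (trans (*-cong (eval-true v e) (eval-true w e')) (*-identityˡ 1#)))

    -- The factors of prodNeG and prodNeH are given by local functions of these definitions,
    -- so the types of factorG-0 and factorH-0 can only be inferred from their uses.
    mutual
      eval-prodNeG-0 : ∀ g F g' → g' ≢ g → (∀ ne → eval (point D) (F g' ne) ≈ 0#) →
                       eval (point D) (prodNeG g F) ≈ 0#
      eval-prodNeG-0 g F g' ne z = eval-prodP-0 (point D) _ (∈-allFin g') (factorG-0 g F g' ne z)

      factorG-0 : ∀ g F g' → g' ≢ g → (∀ ne → eval (point D) (F g' ne) ≈ 0#) → _
      factorG-0 g F g' ne z with g' ≟F g
      ... | yes e = contradiction e ne
      ... | no  _ = z _

    mutual
      eval-prodNeH-0 : ∀ h F h' → h' ≢ h → (∀ ne → eval (point D) (F h' ne) ≈ 0#) →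
                       eval (point D) (prodNeH h F) ≈ 0#
      eval-prodNeH-0 h F h' ne z = eval-prodP-0 (point D) _ (∈-allFin h') (factorH-0 h F h' ne z)

      factorH-0 : ∀ h F h' → h' ≢ h → (∀ ne → eval (point D) (F h' ne) ≈ 0#) → _
      factorH-0 h F h' ne z with h' ≟F h
      ... | yes e = contradiction e ne
      ... | no  _ = z _

    columnFactor : ∀ g (h : Fin nH) g' → g' ≢ g → Poly
    columnFactor g h g' ne = 1P ⊝ (var (edgeG g g' (ne ∘ ≡.sym)) ⊗ var (x g' h))

    rowFactor : ∀ (g : Fin nG) h h' → h' ≢ h → Poly
    rowFactor g h h' ne = 1P ⊝ (var (edgeH h h' (ne ∘ ≡.sym)) ⊗ var (x g h'))

    -- A cell of `D` dominating (g , h) kills one of the three factors: the vertex factor, the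
    -- column product or the row product.
    eval-domX : ∀ g h → (∃ λ g' → combine g' h ∈ˢ D) ⊎ (∃ λ h' → combine g h' ∈ˢ D) →
                eval (point D) (gen (domX g h)) ≈ 0#
    eval-domX g h = go
      where
      vertex column row : Poly
      vertex = 1P ⊝ var (x g h)
      column = prodNeG g (columnFactor g h)
      row    = prodNeH h (rowFactor g h)

      vertex-0 : combine g h ∈ˢ D → eval (point D) (vertex ⊗ (column ⊗ row)) ≈ 0#
      vertex-0 c∈D = eval-⊗-0ˡ (point D) vertex (column ⊗ row)
        (eval-1⊝var (x g h) ([]=⇒lookup c∈D))

      go : (∃ λ g' → combine g' h ∈ˢ D) ⊎ (∃ λ h' → combine g h' ∈ˢ D) →
           eval (point D) (vertex ⊗ (column ⊗ row)) ≈ 0#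
      go (inj₁ (g' , c∈D)) with g' ≟F g
      -- Here the dominating cell is (g , h) itself; the column product has no factor for it, but 1
      -- minus `x g h` vanishes.
      ... | yes refl = vertex-0 c∈D
      ... | no  g'≢g = eval-⊗-0ʳ (point D) vertex (column ⊗ row) (eval-⊗-0ˡ (point D) column row
        (eval-prodNeG-0 g (columnFactor g h) g' g'≢g λ ne →
          eval-edge·vertex (edgeG g g' (ne ∘ ≡.sym)) (x g' h) (point-edgeG D g g' _) ([]=⇒lookup c∈D)))
      go (inj₂ (h' , c∈D)) with h' ≟F h
      ... | yes refl = vertex-0 c∈D
      ... | no  h'≢h = eval-⊗-0ʳ (point D) vertex (column ⊗ row) (eval-⊗-0ʳ (point D) column row
        (eval-prodNeH-0 h (rowFactor g h) h' h'≢h λ ne →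
          eval-edge·vertex (edgeH h h' (ne ∘ ≡.sym)) (x g h') (point-edgeH D h h' _) ([]=⇒lookup c∈D)))

    eval-gen : ¬ Undominated D → ∀ γ → eval (point D) (gen γ) ≈ 0#
    eval-gen dom (boolEG g g' ne) = eval-idempotent (point D) (∈-allVizVars (edgeG g g' ne))
    eval-gen dom (domG g g₁ _ ne) = eval-1⊝var (edgeG g g₁ ne) (point-edgeG D g g₁ ne)
    eval-gen dom (boolEH h h' ne) = eval-idempotent (point D) (∈-allVizVars (edgeH h h' ne))
    eval-gen dom (domH h h₁ _ ne) = eval-1⊝var (edgeH h h₁ ne) (point-edgeH D h h₁ ne)
    eval-gen dom (boolX g h)      = eval-idempotent (point D) (∈-allVizVars (x g h))
    eval-gen dom (domX g h)       = eval-domX g h (dominating dom g h)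

  -- If D is not dominating, it misses a cross, and the difference over that cross
  -- expresses the value at D through the values at strictly larger sets.
  eval-ideal-lowDegree : ∀ p → InIdeal gen p → (∀ g h → All (Avoids (cross g h) ∘ proj₂) p) →
                         ∀ D → eval (point D) p ≈ 0#
  eval-ideal-lowDegree p p∈I low D = go D (⊃-wellFounded D)
    where
    go : ∀ D → Acc _ D → eval (point D) p ≈ 0#
    go D (acc larger) with undominated? D
    ... | no  dom            = eval-ideal (point D) gen (eval-gen D dom) p p∈I
    ... | yes (g , h , miss) = trans
      (sym (diff-leading {cross g h} {λ E → eval (point E) p} miss (λ {E} D⊂E → go E (larger D⊂E))))
      (diff-eval (cross g h) p (low g h) D)

  -- Degree bounds for the Vizing polynomial and for squares.

  module _ (Q : Monomial → Set) where

    All-⊖ : ∀ {p} → All (Q ∘ proj₂) p → All (Q ∘ proj₂) (⊖ p)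
    All-⊖ = Allₚ.map⁺

    All-sumP : ∀ {ps} → All (All (Q ∘ proj₂)) ps → All (Q ∘ proj₂) (sumP ps)
    All-sumP []       = []
    All-sumP (a ∷ as) = Allₚ.++⁺ a (All-sumP as)

  fviz-Avoids : 1 < nG → ∀ g h → All (Avoids (cross g h) ∘ proj₂) fviz
  fviz-Avoids 1<nG g h = Allₚ.++⁺
    (All-sumP (Avoids (cross g h)) (Allₚ.concat⁺ (Allₚ.map⁺ (All.universal (λ g₀ → Allₚ.map⁺
      (All.universal (λ h₀ → singleVar-Avoids 1<nG g₀ h₀ g h ∷ []) (allFin nH))) (allFin nG)))))
    -- The constant monomial avoids every cell; the corner serves as witness.
    ((g , h , column∈cross g h g , refl) ∷ [])

  -- A term of `s ⊗ s` is a product of two terms of degree at most `d`, so its degree is at most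
  -- twice `d`, less than the size of a cross.
  square-Avoids : ∀ {d} → (+ 2) ℤ.* d ℤ.< (+ (nG + nH)) ℤ.- (+ 1) →
                  ∀ {s} → DegLe d s → ∀ g h → All (Avoids (cross g h) ∘ proj₂) (s ⊗ s)
  square-Avoids {d} 2d<N {s} deg g h =
    Allₚ.concat⁺ (Allₚ.map⁺ (All.map (λ {t} dt → Allₚ.map⁺ (All.map (λ {u} du →
      lowDegree⇒Avoids (λ v → proj₂ t v + proj₂ u v) (low (proj₂ t) (proj₂ u) dt du) g h) deg)) deg))
    where
    -- The 1 is moved to the left-hand side, which avoids truncated subtraction on natural numbers.
    low : ∀ m m' → + mdeg m ℤ.≤ d → + mdeg m' ℤ.≤ d → suc (mdeg (λ v → m v + m' v)) < nG + nH
    low m m' dm dm' rewrite mdeg-+ m m' = ℤₚ.drop‿+<+ (begin-strict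
      + suc (mdeg m + mdeg m')                  ≡⟨ ℤₚ.pos-+ 1 (mdeg m + mdeg m') ⟩
      + 1 ℤ.+ (+ mdeg m ℤ.+ + mdeg m')          ≤⟨ ℤₚ.+-monoʳ-≤ (+ 1) (ℤₚ.+-mono-≤ dm dm') ⟩
      + 1 ℤ.+ (d ℤ.+ d)                         ≡⟨ cong (ℤ._+_ (+ 1)) double ⟨
      + 1 ℤ.+ + 2 ℤ.* d                         <⟨ ℤₚ.+-monoʳ-< (+ 1) 2d<N ⟩
      + 1 ℤ.+ (+ (nG + nH) ℤ.- + 1)             ≡⟨ ℤₚ.+-comm (+ 1) (+ (nG + nH) ℤ.- + 1) ⟩
      (+ (nG + nH) ℤ.- + 1) ℤ.+ + 1             ≡⟨ ℤₚ.+-assoc (+ (nG + nH)) (ℤ.- (+ 1)) (+ 1) ⟩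
      + (nG + nH) ℤ.+ + 0                       ≡⟨ ℤₚ.+-identityʳ _ ⟩
      + (nG + nH)                               ∎)
      where
      open ℤₚ.≤-Reasoning
      double : + 2 ℤ.* d ≡ d ℤ.+ d
      double = ≡.trans (ℤₚ.*-distribʳ-+ d (+ 1) (+ 1)) (cong₂ ℤ._+_ (ℤₚ.*-identityˡ d) (ℤₚ.*-identityˡ d))

  -- Positivity of squares and the final contradiction.

  open IsTotalOrder isTotalOrder using (antisym; ≤-respʳ-≈; ≤-respˡ-≈)
    renaming (total to ≤ᴷ-total; refl to ≤ᴷ-refl; trans to ≤ᴷ-trans)

  -- By totality `a` or its negative is nonnegative, and both have the same square.
  square≥0 : ∀ a → 0# ≤ᴷ a *ᴷ a
  square≥0 a with ≤ᴷ-total 0# a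
  ... | inj₁ 0≤a = *-nonneg 0≤a 0≤a
  ... | inj₂ a≤0 = ≤-respʳ-≈ neg² (*-nonneg 0≤-a 0≤-a)
    where
    0≤-a : 0# ≤ᴷ - a
    0≤-a = ≤-respˡ-≈ (-‿inverseʳ a) (≤-respʳ-≈ (+-identityˡ (- a)) (+ᴷ-mono-≤ (- a) a≤0))
    neg² : - a *ᴷ - a ≈ a *ᴷ a
    neg² = trans (sym (-‿distribˡ-* a (- a))) (trans (-‿cong (sym (-‿distribʳ-* a a))) (-‿involutive _))

  sum≥0 : ∀ {a b} → 0# ≤ᴷ a → 0# ≤ᴷ b → 0# ≤ᴷ a +ᴷ b
  sum≥0 {a} {b} 0≤a 0≤b = ≤ᴷ-trans 0≤b (≤-respˡ-≈ (+-identityˡ b) (+ᴷ-mono-≤ b 0≤a))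

  eval-squares≥0 : ∀ σ ss → 0# ≤ᴷ eval σ (sumP (map (λ s → s ⊗ s) ss))
  eval-squares≥0 σ []       = ≤ᴷ-refl
  eval-squares≥0 σ (s ∷ ss) = ≤-respʳ-≈ (sym (linear-⊕ _ (s ⊗ s) _))
    (sum≥0 (≤-respʳ-≈ (sym (eval-⊗ σ s s)) (square≥0 (eval σ s))) (eval-squares≥0 σ ss))

  eval-fviz-⊥ : eval (point ⊥) fviz ≈ - 1#
  eval-fviz-⊥ = trans (eval-⊝ (point ⊥) (sumP vars) 1P)
    (trans (+-cong (eval-sumP-0 (point ⊥) vars vars-0) (-‿cong (eval-1P (point ⊥)))) (+-identityˡ _))
    where
    vars : List Poly
    vars = concatMap (λ g → map (λ h → var (x g h)) (allFin nH)) (allFin nG)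
    vars-0 : All (λ p → eval (point ⊥) p ≈ 0#) vars
    vars-0 = Allₚ.concat⁺ (Allₚ.map⁺ (All.universal (λ g → Allₚ.map⁺ (All.universal (λ h →
      trans (eval-var (point ⊥) (∈-allVizVars (x g h)))
            (reflexive (cong indicator (lookup-replicate (combine g h) false)))) (allFin nH))) (allFin nG)))

  -- At the empty set each `domX` generator has value 1, so ideal membership alone does not force
  -- vanishing there; the degree bound does.
  noLowDegreeSOS : 1 < nG → ∀ d → (+ 2) ℤ.* d ℤ.< (+ (nG + nH)) ℤ.- (+ 1) → ¬ VizSOS d
  noLowDegreeSOS 1<nG d 2d<N (ss , degs , f-Σ∈I) = 0≉1 (antisym 0≤1 1≤0)
    where
    squares : Poly
    squares = sumP (map (λ s → s ⊗ s) ss)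

    avoids : ∀ g h → All (Avoids (cross g h) ∘ proj₂) (fviz ⊝ squares)
    avoids g h = Allₚ.++⁺ (fviz-Avoids 1<nG g h)
      (All-⊖ (Avoids (cross g h)) (All-sumP (Avoids (cross g h))
        (Allₚ.map⁺ (All.map (λ deg → square-Avoids 2d<N deg g h) degs))))

    Σ : Carrier
    Σ = eval (point ⊥) squares

    -1-Σ≈0 : - 1# - Σ ≈ 0#
    -1-Σ≈0 = trans (sym (trans (eval-⊝ (point ⊥) fviz squares) (+-congʳ eval-fviz-⊥)))
                   (eval-ideal-lowDegree (fviz ⊝ squares) f-Σ∈I avoids ⊥)

    Σ≈-1 : Σ ≈ - 1#
    Σ≈-1 = sym (x∙y⁻¹≈ε⇒x≈y (- 1#) Σ -1-Σ≈0)

    0≤1 : 0# ≤ᴷ 1#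
    0≤1 = ≤-respʳ-≈ (*-identityˡ 1#) (square≥0 1#)

    1≤0 : 1# ≤ᴷ 0#
    -- Adding 1 to the inequality 0 ≤ `Σ`, where `Σ` equals the negative of 1, gives 1 ≤ 0.
    1≤0 = ≤-respˡ-≈ (+-identityˡ 1#)
      (≤-respʳ-≈ (trans (+-congʳ Σ≈-1) (-‿inverseˡ 1#)) (+ᴷ-mono-≤ 1# (eval-squares≥0 (point ⊥) ss)))

theorem3p13 : {c ℓ₁ ℓ₂ : Level} (K : ArchimedeanOrderedField c ℓ₁ ℓ₂)
    (nG nH : ℕ) → 1 < nG → 1 < nH →
    (d : ℤ) → (+ 2) ℤ.* d ℤ.< (+ (nG + nH)) ℤ.- (+ 1) →
    ¬ Vizing.VizSOS K nG nH d
theorem3p13 K nG nH 1<nG _ = VizingBound.noLowDegreeSOS K nG nH 1<nG
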